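{- Let $G$ be a finite simple connected graph with at least three vertices and with size (number of edges) $m\ge 2$. Then $\chi'_L(G)=m$ if and only if $G\in\{P_4, C_3, C_4, K_{1,m}\}$.
   Context: $P_4$ is the path on four vertices, $C_n$ the cycle on $n$ vertices, and $K_{1,m}$ the star with $m$ edges. For a proper edge coloring $c:E(G)\to\{1,\dots,k\}$ of $G$, let $\pi=(\mathcal{C}_1,\dots,\mathcal{C}_k)$ be the ordered partition of $E(G)$ into color classes. For a vertex $v$ and an edge $e=xy$, $d(v,e)=\min\{d(v,x),d(v,y)\}$, and $d(v,\mathcal{C}_i)=\min\{d(v,e): e\in\mathcal{C}_i\}$. The edge color code of $v$ is $c_\pi(v)=(d(v,\mathcal{C}_1),\dots,d(v,\mathcal{C}_k))$. The coloring $c$ is an edge-locating coloring if distinct vertices have distinct edge color codes; $\chi'_L(G)$ is the minimum $k$ for which $G$ has an edge-locating coloring with $k$ colors. -}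

module Defs where

open import Data.Nat using (ℕ; zero; suc; _≤_; _≡ᵇ_; _+_; _%_)
open import Data.Fin using (Fin; toℕ) renaming (_<_ to _<ᶠ_)
open import Data.Bool using (Bool; true; false; T; _∧_; _∨_; not)
open import Data.Product using (Σ; _×_; _,_; ∃; proj₁; proj₂)
open import Data.Sum using (_⊎_)
open import Relation.Binary.PropositionalEquality using (_≡_; _≢_)
open import Function.Bundles using (_↔_; Inverse)

Graph : ℕ → Set
Graph n = Fin n → Fin n → Bool

IsSimple : ∀ {n} → Graph n → Set
IsSimple {n} G = (∀ x y → G x y ≡ G y x) × (∀ x → G x x ≡ false)

data Walk {n} (G : Graph n) : Fin n → Fin n → ℕ → Set where
  here : ∀ {x} → Walk G x x 0
  step : ∀ {x y z ℓ} → T (G x y) → Walk G y z ℓ → Walk G x z (suc ℓ)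

Connected : ∀ {n} → Graph n → Set
Connected {n} G = ∀ (u v : Fin n) → ∃ λ ℓ → Walk G u v ℓ

-- Edges: unordered pairs {x,y} represented as x < y with x ~ y.
Edge : ∀ {n} → Graph n → Set
Edge {n} G = Σ (Fin n × Fin n) λ p → (proj₁ p <ᶠ proj₂ p) × T (G (proj₁ p) (proj₂ p))

HasSize : ∀ {n} → Graph n → ℕ → Set
HasSize G m = Fin m ↔ Edge G

Incident : ∀ {n} {G : Graph n} → Fin n → Edge G → Set
Incident w ((x , y) , _) = (w ≡ x) ⊎ (w ≡ y)

-- A proper edge coloring with k colors whose color classes form an
-- (ordered) partition, i.e. every color class is nonempty.
IsProperEdgeColoring : ∀ {n} (G : Graph n) (k : ℕ) → (Edge G → Fin k) → Set
IsProperEdgeColoring {n} G k c =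
  (∀ (e e' : Edge G) (w : Fin n) → e ≢ e' → Incident w e → Incident w e' → c e ≢ c e')
  × (∀ (i : Fin k) → ∃ λ (e : Edge G) → c e ≡ i)

-- DistToClass G c v i d : d(v, C_i) = d, where d(v,C_i) = min over edges e of
-- color i of min over endpoints w of e of d(v,w), and d(v,w) is the length of
-- a shortest walk from v to w.
DistToClass : ∀ {n k} (G : Graph n) → (Edge G → Fin k) → Fin n → Fin k → ℕ → Set
DistToClass {n} G c v i d =
  (∃ λ (e : Edge G) → c e ≡ i × ∃ λ (w : Fin n) → Incident w e × Walk G v w d)
  × (∀ (e : Edge G) (w : Fin n) (d' : ℕ) → c e ≡ i → Incident w e → Walk G v w d' → d ≤ d')

IsEdgeLocating : ∀ {n k} (G : Graph n) → (Edge G → Fin k) → Set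
IsEdgeLocating {n} {k} G c =
  ∀ (u v : Fin n) → u ≢ v →
    ∃ λ (i : Fin k) → ∃ λ d₁ → ∃ λ d₂ →
      DistToClass G c u i d₁ × DistToClass G c v i d₂ × d₁ ≢ d₂

HasEdgeLocatingColoring : ∀ {n} → Graph n → ℕ → Set
HasEdgeLocatingColoring G k =
  Σ (Edge G → Fin k) λ c → IsProperEdgeColoring G k c × IsEdgeLocating G c

EdgeLocatingChromaticIndex : ∀ {n} → Graph n → ℕ → Set
EdgeLocatingChromaticIndex G k =
  HasEdgeLocatingColoring G k × (∀ k' → HasEdgeLocatingColoring G k' → k ≤ k')

_≅_ : ∀ {n n'} → Graph n → Graph n' → Set
_≅_ {n} {n'} G H = Σ (Fin n ↔ Fin n') λ f →
  ∀ x y → G x y ≡ H (Inverse.to f x) (Inverse.to f y)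

P4 : Graph 4
P4 x y = (suc (toℕ x) ≡ᵇ toℕ y) ∨ (suc (toℕ y) ≡ᵇ toℕ x)

C3 : Graph 3
C3 x y = (suc (toℕ x) % 3 ≡ᵇ toℕ y) ∨ (suc (toℕ y) % 3 ≡ᵇ toℕ x)

C4 : Graph 4
C4 x y = (suc (toℕ x) % 4 ≡ᵇ toℕ y) ∨ (suc (toℕ y) % 4 ≡ᵇ toℕ x)

Star : (m : ℕ) → Graph (suc m)
Star m x y = ((toℕ x ≡ᵇ 0) ∧ not (toℕ y ≡ᵇ 0)) ∨ ((toℕ y ≡ᵇ 0) ∧ not (toℕ x ≡ᵇ 0))

{-# OPTIONS --safe #-}

-- A rainbow colouring is always edge-locating, so the index is m exactly when
-- fewer than m colours never suffice.  Giving two disjoint edges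
-- e and f the same colour can only spoil the codes of an end of e and an end of
-- f.  For a path a b c d in which c has a further neighbour, merging ab and cd
-- works; if b and c have degree two and the path extends to a b c d x, merging
-- ab and dx works.  Hence in a graph of index m a path on four vertices spans
-- the whole graph, which is then P4 or C4; without such a path a connected
-- graph is a triangle or a star.  Conversely, if the opposite edges ab and cd of
-- P4 or C4 share their colour, then b and c have the same code.
module Submission where

open import Defs
open import Data.Bool using (true; false; T)
open import Data.Bool.Properties using (T?; T-irrelevant) renaming (_≟_ to _≟ᴮ_)
open import Data.Empty using (⊥; ⊥-elim)
open import Data.Fin using (Fin; zero; suc; punchIn; punchOut)
open import Data.Fin.Properties using (_≟_; <-cmp; <-irrelevant; <-asym; any?; all?; punchInᵢ≢i; punchIn-punchOut; punchIn-injective; punchOut-injective; punchOut-punchIn; punchOut-cong; injective⇒≤)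
open import Data.Nat using (ℕ; zero; suc; _≤_; z≤n; s≤s)
open import Data.Nat.Properties using (≤-trans; ≤-antisym; 1+n≰n)
open import Data.Product using (_×_; _,_; ∃; proj₁; proj₂)
open import Data.Product.Properties using (≡-dec)
open import Data.Sum using (_⊎_; inj₁; inj₂; [_,_]′; map; swap)
open import Data.Vec using (Vec; []; _∷_; lookup)
open import Data.Vec.Relation.Unary.All using ([]; _∷_)
open import Data.Vec.Relation.Unary.AllPairs using ([]; _∷_)
open import Data.Vec.Relation.Unary.Any using (here; there; index)
open import Data.Vec.Relation.Unary.Any.Properties using (lookup-index)
open import Data.Vec.Relation.Unary.Unique.Propositional using (Unique)
open import Data.Vec.Relation.Unary.Unique.Propositional.Properties using (lookup-injective)
import Data.Vec.Membership.DecPropositional as DecMembership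
open import Function using (_∘_; id)
open import Function.Bundles using (_⇔_; mk⇔; Inverse; mk↔ₛ′)
open import Relation.Binary.Definitions using (tri<; tri≈; tri>)
open import Relation.Binary.PropositionalEquality using (_≡_; _≢_; refl; sym; trans; cong; cong₂; subst; ≢-sym)
open import Relation.Nullary using (¬_; Dec; yes; no; contradiction; ¬?; _×-dec_; _⊎-dec_; _→-dec_)
open import Relation.Nullary.Decidable using (map′; from-yes; decidable-stable)

-- Booleans, least witnesses and a third element.

T⇒≡true : ∀ {b} → T b → b ≡ true
T⇒≡true {true} _ = refl

¬T⇒≡false : ∀ {b} → ¬ T b → b ≡ false
¬T⇒≡false {false} _  = refl
¬T⇒≡false {true}  ¬t = ⊥-elim (¬t _)

least : {P : ℕ → Set} → (∀ d → Dec (P d)) → ∀ {d} → P d →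
        ∃ λ d₀ → P d₀ × (∀ d → P d → d₀ ≤ d)
least P? {d} p with P? 0
... | yes p₀ = 0 , p₀ , λ _ _ → z≤n
least P? {zero}  p | no ¬p₀ = contradiction p ¬p₀
least {P} P? {suc d} p | no ¬p₀ =
  let d₀ , p₀ , min = least {P ∘ suc} (P? ∘ suc) p in
  suc d₀ , p₀ , λ { zero q → contradiction q ¬p₀ ; (suc d′) q → s≤s (min d′ q) }

third : ∀ {n} → 3 ≤ n → (u v : Fin n) → ∃ λ t → t ≢ u × t ≢ v
third (s≤s (s≤s (s≤s _))) u v with u ≟ v
... | yes refl = punchIn u zero , punchInᵢ≢i u zero , punchInᵢ≢i u zero
-- Remove `u`, then what `v` becomes in the remaining indices; since `3 ≤ n`, an index survives both
-- removals.
... | no u≢v   = punchIn u t′ , punchInᵢ≢i u t′ , λ eq →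
    punchInᵢ≢i v′ zero (punchIn-injective u t′ v′ (trans eq (sym (punchIn-punchOut u≢v))))
  where
  v′ = punchOut u≢v
  t′ = punchIn v′ zero

-- Identifying two colours.

module _ {m : ℕ} {i j : Fin (suc m)} (i≢j : i ≢ j) where

  -- Removing `i` renumbers the other colours into `Fin m`; colour `i` itself receives the new
  -- number of `j`.
  merge : Fin (suc m) → Fin m
  merge k with i ≟ k
  ... | yes _  = punchOut i≢j
  ... | no i≢k = punchOut i≢k

  merge-fibre : ∀ k l → merge k ≡ merge l → k ≡ l ⊎ (k ≡ i × l ≡ j) ⊎ (k ≡ j × l ≡ i)
  merge-fibre k l eq with i ≟ k | i ≟ l
  ... | yes refl | yes refl = inj₁ refl
  ... | yes refl | no i≢l   = inj₂ (inj₁ (refl , sym (punchOut-injective i≢j i≢l eq)))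
  ... | no i≢k   | yes refl = inj₂ (inj₂ (punchOut-injective i≢k i≢j eq , refl))
  ... | no i≢k   | no i≢l   = inj₁ (punchOut-injective i≢k i≢l eq)

  -- This gives surjectivity of `merge`: a colouring must keep every colour class nonempty.
  merge-punchIn : ∀ k → merge (punchIn i k) ≡ k
  merge-punchIn k with i ≟ punchIn i k
  ... | yes eq = contradiction (sym eq) (punchInᵢ≢i i k)
  ... | no _   = trans (punchOut-cong i refl) (punchOut-punchIn i)

-- Isomorphisms obtained by listing vertices.

≅-enumeration : ∀ {n k} {G : Graph n} {H : Graph k} (v : Fin k → Fin n) →
                (∀ i j → v i ≡ v j → i ≡ j) → (∀ x → ∃ λ i → x ≡ v i) →
                (∀ i j → G (v i) (v j) ≡ H i j) → G ≅ H
≅-enumeration {G = G} v inj surj agree =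
  mk↔ₛ′ (proj₁ ∘ surj) v (λ i → inj _ _ (sym (proj₂ (surj (v i))))) (λ x → sym (proj₂ (surj x))) ,
  λ x y → trans (cong₂ G (proj₂ (surj x)) (proj₂ (surj y))) (agree _ _)

≅-vertices : ∀ {n k} {G : Graph n} {H : Graph k} (vs : Vec (Fin n) k) → let open DecMembership (_≟_ {n}) in
             Unique vs → (∀ x → x ∈ vs) → (∀ i j → G (lookup vs i) (lookup vs j) ≡ H i j) → G ≅ H
≅-vertices vs distinct covers =
  ≅-enumeration (lookup vs) (lookup-injective distinct) (λ x → index (covers x) , lookup-index (covers x))

IsSimple? : ∀ {n} (G : Graph n) → Dec (IsSimple G)
IsSimple? G = (all? λ x → all? λ y → G x y ≟ᴮ G y x) ×-dec (all? λ x → G x x ≟ᴮ false)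

P4-simple : IsSimple P4
P4-simple = from-yes (IsSimple? P4)

C4-simple : IsSimple C4
C4-simple = from-yes (IsSimple? C4)

-- Separation of a single pair of vertices.

Separated : ∀ {n k} (G : Graph n) → (Edge G → Fin k) → Fin n → Fin n → Set
Separated G c u v = ∃ λ i → ∃ λ d₁ → ∃ λ d₂ →
  DistToClass G c u i d₁ × DistToClass G c v i d₂ × d₁ ≢ d₂

separated-sym : ∀ {n k} {G : Graph n} {c : Edge G → Fin k} {u v} →
                Separated G c u v → Separated G c v u
separated-sym (i , d₁ , d₂ , p , q , d₁≢d₂) = i , d₂ , d₁ , q , p , ≢-sym d₁≢d₂

-- Edges, incidence, paths and walks in a simple graph.

module SimpleGraph {n : ℕ} (G : Graph n) (simple : IsSimple G) where

  open DecMembership (_≟_ {n})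

  infix 4 _~_

  _~_ : Fin n → Fin n → Set
  x ~ y = T (G x y)

  ~-sym : ∀ {x y} → x ~ y → y ~ x
  ~-sym = subst T (proj₁ simple _ _)

  ~-irrefl : ∀ {x} → ¬ x ~ x
  ~-irrefl {x} = subst T (proj₂ simple x)

  ~⇒≢ : ∀ {x y} → x ~ y → x ≢ y
  ~⇒≢ x~x refl = ~-irrefl x~x

  edge-ext : (e e′ : Edge G) → proj₁ e ≡ proj₁ e′ → e ≡ e′
  edge-ext (p , l , t) (.p , l′ , t′) refl =
    cong (p ,_) (cong₂ _,_ (<-irrelevant l l′) (T-irrelevant t t′))

  _≟ᴱ_ : (e e′ : Edge G) → Dec (e ≡ e′)
  e ≟ᴱ e′ = map′ (edge-ext e e′) (cong proj₁) (≡-dec _≟_ _≟_ (proj₁ e) (proj₁ e′))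

  incident? : ∀ w (e : Edge G) → Dec (Incident w e)
  incident? w ((x , y) , _) = (w ≟ x) ⊎-dec (w ≟ y)

  otherEnd : ∀ {w} (e : Edge G) → Incident w e → ∃ λ w′ → w ~ w′ × Incident w′ e
  otherEnd ((x , y) , _ , x~y) (inj₁ refl) = y , x~y , inj₂ refl
  otherEnd ((x , y) , _ , x~y) (inj₂ refl) = x , ~-sym x~y , inj₁ refl

  two-ends : ∀ {x y z} (e : Edge G) → x ≢ y → Incident x e → Incident y e → Incident z e →
             z ≡ x ⊎ z ≡ y
  two-ends e x≢y (inj₁ refl) (inj₁ refl) _           = contradiction refl x≢y
  two-ends e x≢y (inj₂ refl) (inj₂ refl) _           = contradiction refl x≢y
  two-ends e x≢y (inj₁ refl) (inj₂ refl) z∈e         = z∈e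
  two-ends e x≢y (inj₂ refl) (inj₁ refl) (inj₁ refl) = inj₂ refl
  two-ends e x≢y (inj₂ refl) (inj₁ refl) (inj₂ refl) = inj₁ refl

  edge-unique : ∀ {x y} (e e′ : Edge G) → x ≢ y → Incident x e → Incident y e →
                Incident x e′ → Incident y e′ → e ≡ e′
  edge-unique e e′ x≢y x∈e y∈e x∈e′ y∈e′ = ends-⊆ e e′ (in-e′ (inj₁ refl)) (in-e′ (inj₂ refl))
    where
    in-e′ : ∀ {z} → Incident z e → Incident z e′
    in-e′ z∈e with two-ends e x≢y x∈e y∈e z∈e
    ... | inj₁ refl = x∈e′
    ... | inj₂ refl = y∈e′

    ends-⊆ : (e e′ : Edge G) → Incident (proj₁ (proj₁ e)) e′ → Incident (proj₂ (proj₁ e)) e′ → e ≡ e′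
    ends-⊆ e@((x , y) , x<y , x~y) e′@((x′ , y′) , x′<y′ , _) p q with p | q
    ... | inj₁ refl | inj₂ refl = edge-ext e e′ refl
    ... | inj₁ refl | inj₁ refl = contradiction x~y ~-irrefl
    ... | inj₂ refl | inj₂ refl = contradiction x~y ~-irrefl
    -- The same two ends in the opposite order would contradict the ordering built into `Edge`.
    ... | inj₂ refl | inj₁ refl = contradiction x<y (<-asym x′<y′)

  -- Describes an edge by its ends alone, so that later arguments need not know which end is smaller
  -- and therefore stored first.
  record Joining (x y : Fin n) : Set where
    field
      edge  : Edge G
      left  : Incident x edge
      right : Incident y edge
      only  : ∀ {w} → Incident w edge → w ≡ x ⊎ w ≡ y

    avoids : ∀ {w} → w ≢ x → w ≢ y → ¬ Incident w edge
    avoids w≢x w≢y w∈e = [ w≢x , w≢y ]′ (only w∈e)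

  open Joining

  joining : ∀ {x y} → x ~ y → Joining x y
  joining {x} {y} x~y with <-cmp x y
  ... | tri< x<y _ _  = record { edge = (x , y) , x<y , x~y ; left = inj₁ refl ; right = inj₂ refl ; only = id }
  ... | tri≈ _ refl _ = contradiction x~y ~-irrefl
  ... | tri> _ _ y<x  = record { edge = (y , x) , y<x , ~-sym x~y ; left = inj₂ refl ; right = inj₁ refl ; only = swap }

  -- Consecutive vertices differ because adjacency is irreflexive, so only the other three
  -- inequalities are recorded. Chords are allowed.
  Path₄ : Fin n → Fin n → Fin n → Fin n → Set
  Path₄ a b c d = a ~ b × b ~ c × c ~ d × a ≢ c × a ≢ d × b ≢ d

  path₄? : Dec (∃ λ a → ∃ λ b → ∃ λ c → ∃ λ d → Path₄ a b c d)
  path₄? = any? λ a → any? λ b → any? λ c → any? λ d →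
    T? (G a b) ×-dec T? (G b c) ×-dec T? (G c d) ×-dec ¬? (a ≟ c) ×-dec ¬? (a ≟ d) ×-dec ¬? (b ≟ d)

  path₄-reverse : ∀ {a b c d} → Path₄ a b c d → Path₄ d c b a
  path₄-reverse (a~b , b~c , c~d , a≢c , a≢d , b≢d) =
    ~-sym c~d , ~-sym b~c , ~-sym a~b , ≢-sym b≢d , ≢-sym a≢d , ≢-sym a≢c

  -- Decidability at each fixed length lets `least` turn a walk into a distance.
  walk? : ∀ ℓ u v → Dec (Walk G u v ℓ)
  walk? zero    u v = map′ (λ { refl → here }) (λ { here → refl }) (u ≟ v)
  walk? (suc ℓ) u v = map′ (λ (_ , p , w) → step p w) (λ { (step p w) → _ , p , w })
                           (any? λ y → T? (G u y) ×-dec walk? ℓ y v)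

  -- Follow the walk to its first step out of `S`.
  escape : {S : Fin n → Set} → (∀ x → Dec (S x)) → ∀ {u t ℓ} → Walk G u t ℓ → S u → ¬ S t →
           ∃ λ x → ∃ λ y → S x × ¬ S y × x ~ y
  escape S? here u∈S t∉S = contradiction u∈S t∉S
  escape S? (step {u} {y} u~y w) u∈S t∉S with S? y
  ... | yes y∈S = escape S? w y∈S t∉S
  ... | no y∉S  = u , y , u∈S , y∉S , u~y

  -- Connected graphs and the rainbow colouring.

  module ConnectedGraph (conn : Connected G) (3≤n : 3 ≤ n) where

    covers-or-exits : {S : Fin n → Set} → (∀ x → Dec (S x)) → ∀ {u} → S u →
                      (∀ x → S x) ⊎ ∃ λ x → ∃ λ y → S x × ¬ S y × x ~ y
    covers-or-exits S? u∈S with any? (¬? ∘ S?)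
    ... | yes (t , t∉S) = inj₂ (escape S? (proj₂ (conn _ t)) u∈S t∉S)
    ... | no none       = inj₁ λ x → decidable-stable (S? x) λ x∉S → none (x , x∉S)

    -- A walk to a third vertex must leave the pair. The edge on which it leaves meets one of `u`,
    -- `v` and misses the other when they differ, which is the source of all separations by
    -- incidence.
    pair-exit : ∀ u v → ∃ λ w → w ≢ u × w ≢ v × (u ~ w ⊎ v ~ w)
    pair-exit u v with third 3≤n u v
    ... | t , t≢u , t≢v with escape (λ x → (x ≟ u) ⊎-dec (x ≟ v)) (proj₂ (conn u t)) (inj₁ refl) [ t≢u , t≢v ]′
    ... | _ , y , inj₁ refl , y∉ , u~y = y , y∉ ∘ inj₁ , y∉ ∘ inj₂ , inj₁ u~y
    ... | _ , y , inj₂ refl , y∉ , v~y = y , y∉ ∘ inj₁ , y∉ ∘ inj₂ , inj₂ v~y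

    cherry : ∃ λ a → ∃ λ b → ∃ λ c → b ~ a × b ~ c × a ≢ c
    -- Exiting from the pair `v`, `v` yields a neighbour `w`; exiting from `v`, `w` yields a second
    -- edge at `v` or at `w`.
    cherry = let v = vertex 3≤n in extend (pair-exit v v)
      where
      vertex : ∀ {n} → 3 ≤ n → Fin n
      vertex (s≤s _) = zero

      extend : ∀ {v} → (∃ λ w → w ≢ v × w ≢ v × (v ~ w ⊎ v ~ w)) → ∃ λ a → ∃ λ b → ∃ λ c → b ~ a × b ~ c × a ≢ c
      extend {v} (w , _ , _ , v~w) with pair-exit v w | [ id , id ]′ v~w
      ... | z , z≢v , z≢w , inj₁ v~z | v~w = w , v , z , v~w , v~z , ≢-sym z≢w
      ... | z , z≢v , z≢w , inj₂ w~z | v~w = v , w , z , ~-sym v~w , w~z , ≢-sym z≢v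

    module Sized {m : ℕ} (size : HasSize G m) where

      open Inverse size using (to; from; strictlyInverseˡ; strictlyInverseʳ)

      from-injective : ∀ {e e′} → from e ≡ from e′ → e ≡ e′
      from-injective {e} {e′} eq = trans (sym (strictlyInverseˡ e)) (trans (cong to eq) (strictlyInverseˡ e′))

      distToClass : ∀ {k} (c : Edge G → Fin k) v g → ∃ λ d → DistToClass G c v (c g) d
      distToClass c v g@((x , _) , _) =
        let d , reach , min = least reaches? (g , refl , x , inj₁ refl , proj₂ (conn v x)) in
        d , reach , λ e w d′ ce≡ w∈e walk → min d′ (e , ce≡ , w , w∈e , walk)
        where
        Reaches : ℕ → Edge G → Set
        Reaches d e = c e ≡ c g × ∃ λ w → Incident w e × Walk G v w d

        reaches? : ∀ d → Dec (∃ (Reaches d))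
        -- The search for an edge runs over the numbers that `size` gives to the edges.
        reaches? d = map′ (λ (i , r) → to i , r)
                          (λ (e , r) → from e , subst (Reaches d) (sym (strictlyInverseˡ e)) r)
                          (any? λ i → (c (to i) ≟ c g) ×-dec any? λ w → incident? w (to i) ×-dec walk? d v w)

      -- The class of `g` is at distance 0 from `u` and at positive distance from `v`.
      separated-by-incidence : ∀ {k} (c : Edge G → Fin k) {u v} g → Incident u g →
                               (∀ h → c h ≡ c g → ¬ Incident v h) → Separated G c u v
      separated-by-incidence c {u} {v} g u∈g v∉class with distToClass c v g
      ... | zero , (h , ch≡ , _ , v∈h , here) , _ = contradiction v∈h (v∉class h ch≡)
      ... | suc d , dist = c g , 0 , suc d , ((g , refl , u , u∈g , here) , λ _ _ _ _ _ _ → z≤n) , dist , λ ()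

      -- Each class is a single edge, so the edge found by `pair-exit` separates the two vertices.
      rainbow-locating : HasEdgeLocatingColoring G m
      rainbow-locating = from , ((λ e e′ w e≢e′ _ _ → e≢e′ ∘ from-injective) , λ i → to i , strictlyInverseʳ i) , locates
        where
        by-edge : ∀ {u v w} → u ≢ v → w ≢ v → u ~ w → Separated G from u v
        by-edge {u} {v} u≢v w≢v u~w = separated-by-incidence from (edge j) (left j) λ h eq v∈h →
            avoids j (≢-sym u≢v) (≢-sym w≢v) (subst (Incident v) (from-injective eq) v∈h)
          where j = joining u~w

        locates : IsEdgeLocating G from
        locates u v u≢v with pair-exit u v
        ... | w , w≢u , w≢v , inj₁ u~w = by-edge u≢v w≢v u~w
        ... | w , w≢u , w≢v , inj₂ v~w = separated-sym (by-edge (≢-sym u≢v) w≢u v~w)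

    -- Giving two disjoint edges the same colour.

    module Merging {m : ℕ} (size : HasSize G (suc m)) {a b c d : Fin n} (a~b : a ~ b) (c~d : c ~ d)
                   (a≢c : a ≢ c) (a≢d : a ≢ d) (b≢c : b ≢ c) (b≢d : b ≢ d) where

      open Inverse size using (to; from; strictlyInverseʳ)
      open Sized size

      e f : Edge G
      e = edge (joining a~b)
      f = edge (joining c~d)

      disjoint : ∀ {w} → Incident w e → ¬ Incident w f
      disjoint w∈e w∈f with only (joining a~b) w∈e | only (joining c~d) w∈f
      ... | inj₁ refl | inj₁ eq = a≢c eq
      ... | inj₁ refl | inj₂ eq = a≢d eq
      ... | inj₂ refl | inj₁ eq = b≢c eq
      ... | inj₂ refl | inj₂ eq = b≢d eq

      e≢f : from e ≢ from f
      e≢f eq = disjoint (left (joining a~b)) (subst (Incident a) (from-injective eq) (left (joining a~b)))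

      colour : Edge G → Fin m
      colour g = merge e≢f (from g)

      colour-fibre : ∀ g h → colour g ≡ colour h → g ≡ h ⊎ (g ≡ e × h ≡ f) ⊎ (g ≡ f × h ≡ e)
      colour-fibre g h eq with merge-fibre e≢f (from g) (from h) eq
      ... | inj₁ p              = inj₁ (from-injective p)
      ... | inj₂ (inj₁ (p , q)) = inj₂ (inj₁ (from-injective p , from-injective q))
      ... | inj₂ (inj₂ (p , q)) = inj₂ (inj₂ (from-injective p , from-injective q))

      colour-proper : IsProperEdgeColoring G m colour
      colour-proper = proper , λ i → to (punchIn (from e) i) ,
          trans (cong (merge e≢f) (strictlyInverseʳ _)) (merge-punchIn e≢f i)
        where
        proper : ∀ g h w → g ≢ h → Incident w g → Incident w h → colour g ≢ colour h
        proper g h w g≢h w∈g w∈h eq with colour-fibre g h eq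
        ... | inj₁ g≡h                  = g≢h g≡h
        ... | inj₂ (inj₁ (refl , refl)) = disjoint w∈g w∈h
        ... | inj₂ (inj₂ (refl , refl)) = disjoint w∈h w∈g

      -- Every other edge remains alone in its class and can be used as in the rainbow colouring.
      unmerged : ∀ {g} → g ≢ e → g ≢ f → ∀ h → colour h ≡ colour g → h ≡ g
      unmerged g≢e g≢f h eq with colour-fibre h _ eq
      ... | inj₁ h≡g              = h≡g
      ... | inj₂ (inj₁ (_ , g≡f)) = contradiction g≡f g≢f
      ... | inj₂ (inj₂ (_ , g≡e)) = contradiction g≡e g≢e

      Unmerged : ∀ {x y} → x ~ y → Set
      Unmerged x~y = edge (joining x~y) ≢ e × edge (joining x~y) ≢ f

      separated-at : ∀ {x y v} (x~y : x ~ y) → Unmerged x~y → x ≢ v → y ≢ v → Separated G colour x v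
      separated-at {v = v} x~y (≢e , ≢f) x≢v y≢v =
          separated-by-incidence colour (edge j) (left j) λ h eq v∈h →
            avoids j (≢-sym x≢v) (≢-sym y≢v) (subst (Incident v) (unmerged ≢e ≢f h eq) v∈h)
        where j = joining x~y

      -- u is at distance 1 and v at distance 2 from the edge xy.
      separated-by-distance : ∀ {x y z u v w} (x~y : x ~ y) → Unmerged x~y → u ~ x → u ≢ y →
                              v ~ w → w ~ z → Incident z (edge (joining x~y)) → v ≢ x → v ≢ y → ¬ v ~ x → ¬ v ~ y → Separated G colour u v
      separated-by-distance {x} {y} {z} {u} {v} x~y (≢e , ≢f) u~x u≢y v~w w~z z∈xy v≢x v≢y v≁x v≁y =
          colour (edge j) , 1 , 2 ,
          ((edge j , refl , x , left j , step u~x here) , from-u) ,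
          ((edge j , refl , z , z∈xy , step v~w (step w~z here)) , from-v) , λ ()
        where
        j = joining x~y

        ends : ∀ {z} h → colour h ≡ colour (edge j) → Incident z h → z ≡ x ⊎ z ≡ y
        ends {z} h eq z∈h = only j (subst (Incident z) (unmerged ≢e ≢f h eq) z∈h)

        from-u : ∀ h z d → colour h ≡ colour (edge j) → Incident z h → Walk G u z d → 1 ≤ d
        from-u h z (suc d) eq z∈h _ = s≤s z≤n
        from-u h z zero eq z∈h here = contradiction (ends h eq z∈h) [ ~⇒≢ u~x , u≢y ]′

        from-v : ∀ h z d → colour h ≡ colour (edge j) → Incident z h → Walk G v z d → 2 ≤ d
        from-v h z (suc (suc d)) eq z∈h _ = s≤s (s≤s z≤n)
        from-v h z zero eq z∈h here = contradiction (ends h eq z∈h) [ v≢x , v≢y ]′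
        from-v h z (suc zero) eq z∈h (step v~z here) with ends h eq z∈h
        ... | inj₁ refl = contradiction v~z v≁x
        ... | inj₂ refl = contradiction v~z v≁y

      -- One end off `ab` and one end off `cd`, possibly the same end, tell the edge apart from `e`
      -- and `f`.
      unmerged-by : ∀ {x y} (x~y : x ~ y) → (x ≢ a × x ≢ b) ⊎ (y ≢ a × y ≢ b) →
                    (x ≢ c × x ≢ d) ⊎ (y ≢ c × y ≢ d) → Unmerged x~y
      unmerged-by x~y off-e off-f = differs (joining a~b) off-e , differs (joining c~d) off-f
        where
        j = joining x~y
        differs : ∀ {p q} (j′ : Joining p q) → (_ ≢ p × _ ≢ q) ⊎ (_ ≢ p × _ ≢ q) → edge j ≢ edge j′
        differs j′ (inj₁ (≢p , ≢q)) eq = avoids j′ ≢p ≢q (subst (Incident _) eq (left j))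
        differs j′ (inj₂ (≢p , ≢q)) eq = avoids j′ ≢p ≢q (subst (Incident _) eq (right j))

      -- Let `uw` be an edge missing `v`. If it is not merged, its class separates `u` from `v`. If
      -- it is `e`, the class of `e` and `f` does so unless `v` lies on `f`, and symmetrically for
      -- `f`. What remains are the four pairs with one vertex on each merged edge.
      merged-locating : Separated G colour a c → Separated G colour a d →
                        Separated G colour b c → Separated G colour b d → HasEdgeLocatingColoring G m
      merged-locating ac ad bc bd = colour , colour-proper , locates
        where
        across : ∀ {u v} → Incident u e → Incident v f → Separated G colour u v
        across u∈e v∈f with only (joining a~b) u∈e | only (joining c~d) v∈f
        ... | inj₁ refl | inj₁ refl = ac
        ... | inj₁ refl | inj₂ refl = ad
        ... | inj₂ refl | inj₁ refl = bc
        ... | inj₂ refl | inj₂ refl = bd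

        by-edge : ∀ {u v w} → u ≢ v → w ≢ v → u ~ w → Separated G colour u v
        by-edge {u} {v} u≢v w≢v u~w with edge (joining u~w) ≟ᴱ e | edge (joining u~w) ≟ᴱ f
        ... | no ≢e  | no ≢f = separated-at u~w (≢e , ≢f) u≢v w≢v
        ... | yes ≡e | _ with incident? v f
        ...   | yes v∈f = across (subst (Incident u) ≡e (left (joining u~w))) v∈f
        ...   | no v∉f  = separated-by-incidence colour e (subst (Incident u) ≡e (left (joining u~w))) avoid
          where
          v∉e : ¬ Incident v e
          v∉e = avoids (joining u~w) (≢-sym u≢v) (≢-sym w≢v) ∘ subst (Incident v) (sym ≡e)
          avoid : ∀ h → colour h ≡ colour e → ¬ Incident v h
          avoid h eq with colour-fibre h e eq
          ... | inj₁ refl              = v∉e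
          ... | inj₂ (inj₁ (refl , _)) = v∉e
          ... | inj₂ (inj₂ (refl , _)) = v∉f
        by-edge {u} {v} u≢v w≢v u~w | _ | yes ≡f with incident? v e
        ...   | yes v∈e = separated-sym (across v∈e (subst (Incident u) ≡f (left (joining u~w))))
        ...   | no v∉e  = separated-by-incidence colour f (subst (Incident u) ≡f (left (joining u~w))) avoid
          where
          v∉f : ¬ Incident v f
          v∉f = avoids (joining u~w) (≢-sym u≢v) (≢-sym w≢v) ∘ subst (Incident v) (sym ≡f)
          avoid : ∀ h → colour h ≡ colour f → ¬ Incident v h
          avoid h eq with colour-fibre h f eq
          ... | inj₁ refl              = v∉f
          ... | inj₂ (inj₁ (refl , _)) = v∉e
          ... | inj₂ (inj₂ (refl , _)) = v∉f

        locates : IsEdgeLocating G colour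
        locates u v u≢v with pair-exit u v
        ... | w , w≢u , w≢v , inj₁ u~w = by-edge u≢v w≢v u~w
        ... | w , w≢u , w≢v , inj₂ v~w = separated-sym (by-edge (≢-sym u≢v) w≢u v~w)

    -- Two configurations in which one colour can be saved.

    -- Merge `ab` and `cd`. The edge `bc` separates `c` from `a` and `b` from `d`, and `cy`
    -- separates `c` from `b`; only the pair `a`, `d` needs cases. The vertex `y` may be `a`.
    branching-path-reducible : ∀ {m a b c d y} → HasSize G (suc m) → Path₄ a b c d →
                               c ~ y → y ≢ b → y ≢ d → HasEdgeLocatingColoring G m
    branching-path-reducible {m} {a} {b} {c} {d} {y} size (a~b , b~c , c~d , a≢c , a≢d , b≢d) c~y y≢b y≢d =
      merged-locating
        (separated-sym (separated-at (~-sym b~c) bc-unmerged′ (≢-sym a≢c) (≢-sym a≢b)))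
        ad-separated
        (separated-sym (separated-at c~y cy-unmerged (≢-sym b≢c) y≢b))
        (separated-at b~c bc-unmerged b≢d c≢d)
      where
      a≢b = ~⇒≢ a~b
      b≢c = ~⇒≢ b~c
      c≢d = ~⇒≢ c~d
      open Merging size a~b c~d a≢c a≢d b≢c b≢d
      bc-unmerged  = unmerged-by b~c (inj₂ (≢-sym a≢c , ≢-sym b≢c)) (inj₁ (b≢c , b≢d))
      bc-unmerged′ = unmerged-by (~-sym b~c) (inj₁ (≢-sym a≢c , ≢-sym b≢c)) (inj₂ (b≢c , b≢d))
      cy-unmerged  = unmerged-by c~y (inj₁ (≢-sym a≢c , ≢-sym b≢c)) (inj₂ (≢-sym (~⇒≢ c~y) , y≢d))

      ad-separated : Separated G colour a d
      -- An edge from `a` to `c` or `y` misses `d`. Without one, `cy` is at distance 1 from `d` and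
      -- 2 from `a`, along `a b c`; here `y` is not `a`, since `a` and `c` are not adjacent.
      ad-separated with T? (G a c) | T? (G a y)
      ... | yes a~c | _ = separated-at a~c
            (unmerged-by a~c (inj₂ (≢-sym a≢c , ≢-sym b≢c)) (inj₁ (a≢c , a≢d))) a≢d c≢d
      ... | no _ | yes a~y = separated-at a~y
            (unmerged-by a~y (inj₂ (≢-sym (~⇒≢ a~y) , y≢b)) (inj₁ (a≢c , a≢d))) a≢d y≢d
      ... | no a≁c | no a≁y = separated-sym (separated-by-distance c~y cy-unmerged (~-sym c~d) (≢-sym y≢d)
            a~b b~c (left (joining c~y)) a≢c (λ { refl → a≁c (~-sym c~y) }) a≁c a≁y)

    -- Merge `ab` and `dx`. The edge `cd` separates `d` from `a`, and `bc` separates `b` from `d`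
    -- and from `x`. Finally `bc` is at distance 1 from `a` but 2 from `x`, because `x` is adjacent
    -- to neither `b` nor `c`.
    long-path-reducible : ∀ {m a b c d x} → HasSize G (suc m) → Path₄ a b c d →
                          d ~ x → x ≢ a → x ≢ b → x ≢ c → ¬ b ~ x → ¬ c ~ x → HasEdgeLocatingColoring G m
    long-path-reducible {m} {a} {b} {c} {d} {x} size (a~b , b~c , c~d , a≢c , a≢d , b≢d) d~x x≢a x≢b x≢c b≁x c≁x =
      merged-locating
        (separated-sym (separated-at (~-sym c~d) cd-unmerged (≢-sym a≢d) (≢-sym a≢c)))
        (separated-by-distance b~c bc-unmerged a~b a≢c
          (~-sym d~x) (~-sym c~d) (right (joining b~c)) x≢b x≢c (b≁x ∘ ~-sym) (c≁x ∘ ~-sym))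
        (separated-at b~c bc-unmerged b≢d c≢d)
        (separated-at b~c bc-unmerged (≢-sym x≢b) (≢-sym x≢c))
      where
      b≢c = ~⇒≢ b~c
      c≢d = ~⇒≢ c~d
      open Merging size a~b d~x a≢d (≢-sym x≢a) b≢d (≢-sym x≢b)
      bc-unmerged = unmerged-by b~c (inj₂ (≢-sym a≢c , ≢-sym b≢c)) (inj₁ (b≢d , ≢-sym x≢b))
      cd-unmerged = unmerged-by (~-sym c~d) (inj₁ (≢-sym a≢d , ≢-sym b≢d)) (inj₂ (c≢d , ≢-sym x≢c))

    -- Irreducible graphs containing a path on four vertices.

    module Irreducible {m : ℕ} (size : HasSize G (suc m)) (irreducible : ¬ HasEdgeLocatingColoring G m) where

      inner-degree-two : ∀ {a b c d y} → Path₄ a b c d → c ~ y → y ≡ b ⊎ y ≡ d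
      inner-degree-two {b = b} {d = d} {y} path c~y =
        decidable-stable ((y ≟ b) ⊎-dec (y ≟ d)) λ y∉ →
          irreducible (branching-path-reducible size path c~y (y∉ ∘ inj₁) (y∉ ∘ inj₂))

      -- The inner vertices have no neighbours off the path, so `x` is adjacent to neither of them
      -- and the path extended by `x` is reducible.
      path-end-exit : ∀ {a b c d x} → Path₄ a b c d → ¬ x ∈ (a ∷ b ∷ c ∷ d ∷ []) → ¬ d ~ x
      path-end-exit path x∉ d~x = irreducible (long-path-reducible size path d~x
        (x∉ ∘ here) (x∉ ∘ there ∘ here) (x∉ ∘ there ∘ there ∘ here)
        (λ b~x → [ (λ { refl → x∉ (there (there (here refl))) }) , (λ { refl → x∉ (here refl) }) ]′
                   (inner-degree-two (path₄-reverse path) b~x))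
        (λ c~x → [ (λ { refl → x∉ (there (here refl)) }) , (λ { refl → x∉ (there (there (there (here refl)))) }) ]′
                   (inner-degree-two path c~x)))

      -- By connectedness it is enough that no edge leaves the path: the ends are handled by
      -- `path-end-exit` in both directions, the inner vertices by their degree.
      path-covers : ∀ {a b c d} → Path₄ a b c d → ∀ x → x ∈ (a ∷ b ∷ c ∷ d ∷ [])
      path-covers {a} {b} {c} {d} path with covers-or-exits (_∈? (a ∷ b ∷ c ∷ d ∷ [])) (here refl)
      ... | inj₁ covers = covers
      ... | inj₂ (_ , y , there (there (there (here refl))) , y∉ , d~y) = contradiction d~y (path-end-exit path y∉)
      ... | inj₂ (_ , y , here refl , y∉ , a~y) =
              contradiction a~y (path-end-exit (path₄-reverse path) λ
                { (here refl) → y∉ (there (there (there (here refl))))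
                ; (there (here refl)) → y∉ (there (there (here refl)))
                ; (there (there (here refl))) → y∉ (there (here refl))
                ; (there (there (there (here refl)))) → y∉ (here refl) })
      ... | inj₂ (_ , y , there (here refl) , y∉ , b~y) with inner-degree-two (path₄-reverse path) b~y
      ...   | inj₁ refl = contradiction (there (there (here refl))) y∉
      ...   | inj₂ refl = contradiction (here refl) y∉
      path-covers path | inj₂ (_ , y , there (there (here refl)) , y∉ , c~y) with inner-degree-two path c~y
      ...   | inj₁ refl = contradiction (there (here refl)) y∉
      ...   | inj₂ refl = contradiction (there (there (there (here refl)))) y∉

      path⇒P4-or-C4 : ∀ {a b c d} → Path₄ a b c d → G ≅ P4 ⊎ G ≅ C4
      path⇒P4-or-C4 {a} {b} {c} {d} path@(a~b , b~c , c~d , a≢c , a≢d , b≢d) = by-closing (T? (G a d))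
        where
        vs = a ∷ b ∷ c ∷ d ∷ []

        distinct : Unique vs
        distinct = (~⇒≢ a~b ∷ a≢c ∷ a≢d ∷ []) ∷ (~⇒≢ b~c ∷ b≢d ∷ []) ∷ (~⇒≢ c~d ∷ []) ∷ [] ∷ []

        -- Either of the chords `ac` and `bd` would give an inner vertex a third neighbour.
        a≁c : ¬ a ~ c
        a≁c a~c = [ ~⇒≢ a~b , a≢d ]′ (inner-degree-two path (~-sym a~c))

        b≁d : ¬ b ~ d
        b≁d b~d = [ ≢-sym (~⇒≢ c~d) , ≢-sym a≢d ]′ (inner-degree-two (path₄-reverse path) b~d)

        -- `P4` and `C4` differ only in the pair of end vertices, so one table with that entry left
        -- open serves both.
        agree : ∀ {H : Graph 4} → IsSimple H →
                H zero (suc zero) ≡ true → H zero (suc (suc zero)) ≡ false →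
                H (suc zero) (suc (suc zero)) ≡ true → H (suc zero) (suc (suc (suc zero))) ≡ false →
                H (suc (suc zero)) (suc (suc (suc zero))) ≡ true →
                G a d ≡ H zero (suc (suc (suc zero))) →
                ∀ i j → G (lookup vs i) (lookup vs j) ≡ H i j
        agree {H} H-simple h₀₁ h₀₂ h₁₂ h₁₃ h₂₃ ad = go
          where
          G₀₁ = trans (T⇒≡true a~b) (sym h₀₁)
          G₀₂ = trans (¬T⇒≡false a≁c) (sym h₀₂)
          G₁₂ = trans (T⇒≡true b~c) (sym h₁₂)
          G₁₃ = trans (¬T⇒≡false b≁d) (sym h₁₃)
          G₂₃ = trans (T⇒≡true c~d) (sym h₂₃)

          flip : ∀ {x y i j} → G x y ≡ H i j → G y x ≡ H j i
          flip eq = trans (proj₁ simple _ _) (trans eq (proj₁ H-simple _ _))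

          diagonal : ∀ {x i} → G x x ≡ H i i
          diagonal = trans (proj₂ simple _) (sym (proj₂ H-simple _))

          go : ∀ i j → G (lookup vs i) (lookup vs j) ≡ H i j
          go zero zero = diagonal
          go zero (suc zero) = G₀₁
          go zero (suc (suc zero)) = G₀₂
          go zero (suc (suc (suc zero))) = ad
          go (suc zero) zero = flip G₀₁
          go (suc zero) (suc zero) = diagonal
          go (suc zero) (suc (suc zero)) = G₁₂
          go (suc zero) (suc (suc (suc zero))) = G₁₃
          go (suc (suc zero)) zero = flip G₀₂
          go (suc (suc zero)) (suc zero) = flip G₁₂
          go (suc (suc zero)) (suc (suc zero)) = diagonal
          go (suc (suc zero)) (suc (suc (suc zero))) = G₂₃
          go (suc (suc (suc zero))) zero = flip ad
          go (suc (suc (suc zero))) (suc zero) = flip G₁₃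
          go (suc (suc (suc zero))) (suc (suc zero)) = flip G₂₃
          go (suc (suc (suc zero))) (suc (suc (suc zero))) = diagonal

        by-closing : Dec (a ~ d) → G ≅ P4 ⊎ G ≅ C4
        by-closing (yes a~d) = inj₂ (≅-vertices vs distinct (path-covers path)
          (agree C4-simple refl refl refl refl refl (T⇒≡true a~d)))
        by-closing (no a≁d) = inj₁ (≅-vertices vs distinct (path-covers path)
          (agree P4-simple refl refl refl refl refl (¬T⇒≡false a≁d)))

    -- Graphs without a path on four vertices.

    module PathFree {m : ℕ} (size : HasSize G m) (no-path : ∀ {a b c d} → ¬ Path₄ a b c d) where

      triangle⇒C3 : ∀ {a b c} → a ~ b → b ~ c → a ~ c → G ≅ C3
      triangle⇒C3 {a} {b} {c} a~b b~c a~c = ≅-vertices vs distinct covers agree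
        where
        vs = a ∷ b ∷ c ∷ []

        distinct : Unique vs
        distinct = (~⇒≢ a~b ∷ ~⇒≢ a~c ∷ []) ∷ (~⇒≢ b~c ∷ []) ∷ [] ∷ []

        -- Otherwise `t x y z` would be such a path.
        no-exit : ∀ {x y z t} → x ~ y → y ~ z → x ~ z → t ≢ y → t ≢ z → ¬ x ~ t
        no-exit x~y y~z x~z t≢y t≢z x~t = no-path (~-sym x~t , x~y , y~z , t≢y , t≢z , ~⇒≢ x~z)

        covers : ∀ x → x ∈ vs
        covers with covers-or-exits (_∈? vs) (here refl)
        ... | inj₁ all = all
        ... | inj₂ (_ , t , here refl , t∉ , a~t) =
                contradiction a~t (no-exit a~b b~c a~c (t∉ ∘ there ∘ here) (t∉ ∘ there ∘ there ∘ here))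
        ... | inj₂ (_ , t , there (here refl) , t∉ , b~t) =
                contradiction b~t (no-exit b~c (~-sym a~c) (~-sym a~b) (t∉ ∘ there ∘ there ∘ here) (t∉ ∘ here))
        ... | inj₂ (_ , t , there (there (here refl)) , t∉ , c~t) =
                contradiction c~t (no-exit (~-sym a~c) a~b (~-sym b~c) (t∉ ∘ here) (t∉ ∘ there ∘ here))

        agree : ∀ i j → G (lookup vs i) (lookup vs j) ≡ C3 i j
        agree zero zero = proj₂ simple _
        agree zero (suc zero) = T⇒≡true a~b
        agree zero (suc (suc zero)) = T⇒≡true a~c
        agree (suc zero) zero = T⇒≡true (~-sym a~b)
        agree (suc zero) (suc zero) = proj₂ simple _
        agree (suc zero) (suc (suc zero)) = T⇒≡true b~c
        agree (suc (suc zero)) zero = T⇒≡true (~-sym a~c)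
        agree (suc (suc zero)) (suc zero) = T⇒≡true (~-sym b~c)
        agree (suc (suc zero)) (suc (suc zero)) = proj₂ simple _

      open-cherry⇒Star : ∀ {a b c} → b ~ a → b ~ c → a ≢ c → ¬ a ~ c → G ≅ Star m
      open-cherry⇒Star {a} {b} {c} b~a b~c a≢c a≁c =
          ≅-enumeration vertex vertex-injective vertex-surjective agree
        where
        open Inverse size using (to; from; strictlyInverseˡ; strictlyInverseʳ)

        -- If `y` were not `b`, then since `a` and `c` are distinct and nonadjacent, one of them,
        -- say `t`, would differ from both `z` and `y`, and `y z b t` would be a path.
        leaf : ∀ {z y} → b ~ z → z ~ y → y ≡ b
        leaf {z} {y} b~z z~y = decidable-stable (y ≟ b) λ y≢b →
            [ (λ { refl → meets (λ { refl → a≢c refl }) (λ { refl → a≁c z~y }) b~c y≢b })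
            , (λ a≢z → [ (λ { refl → meets (λ { refl → a≁c (~-sym z~y) }) a≢c b~c y≢b })
                       , (λ a≢y → meets (≢-sym a≢z) (≢-sym a≢y) b~a y≢b) ]′ (split a y)) ]′ (split a z)
          where
          split : (x y : Fin n) → x ≡ y ⊎ x ≢ y
          split x y with x ≟ y
          ... | yes p = inj₁ p
          ... | no p  = inj₂ p

          meets : ∀ {t} → z ≢ t → y ≢ t → b ~ t → y ≢ b → ⊥
          meets z≢t y≢t b~t y≢b = no-path (~-sym z~y , ~-sym b~z , b~t , y≢b , y≢t , z≢t)

        -- No edge leaves the closed neighbourhood of `b`, because `leaf` sends every neighbour of
        -- `b` back to `b`.
        near-centre : ∀ x → x ≡ b ⊎ b ~ x
        near-centre with covers-or-exits (λ x → (x ≟ b) ⊎-dec T? (G b x)) (inj₁ refl)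
        ... | inj₁ all = all
        ... | inj₂ (_ , y , inj₁ refl , y∉ , b~y) = contradiction (inj₂ b~y) y∉
        ... | inj₂ (_ , y , inj₂ b~x , y∉ , x~y)  = contradiction (inj₁ (leaf b~x x~y)) y∉

        centre∈ : ∀ e → Incident b e
        centre∈ ((x , y) , _ , x~y) with near-centre x
        ... | inj₁ refl = inj₁ refl
        ... | inj₂ b~x  = inj₂ (sym (leaf b~x x~y))

        -- All edges pass through `b`, so numbering the leaves by their edges makes the star have
        -- exactly `m` of them.
        vertex : Fin (suc m) → Fin n
        vertex zero    = b
        vertex (suc i) = proj₁ (otherEnd (to i) (centre∈ (to i)))

        centre~ : ∀ i → b ~ vertex (suc i)
        centre~ i = proj₁ (proj₂ (otherEnd (to i) (centre∈ (to i))))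

        vertex∈ : ∀ i → Incident (vertex (suc i)) (to i)
        vertex∈ i = proj₂ (proj₂ (otherEnd (to i) (centre∈ (to i))))

        vertex-injective : ∀ i j → vertex i ≡ vertex j → i ≡ j
        vertex-injective zero    zero    _  = refl
        vertex-injective zero    (suc j) eq = contradiction eq (~⇒≢ (centre~ j))
        vertex-injective (suc i) zero    eq = contradiction (sym eq) (~⇒≢ (centre~ i))
        vertex-injective (suc i) (suc j) eq = cong suc (trans (sym (strictlyInverseʳ i)) (trans (cong from
          (edge-unique (to i) (to j) (~⇒≢ (centre~ i)) (centre∈ (to i)) (vertex∈ i) (centre∈ (to j))
            (subst (λ w → Incident w (to j)) (sym eq) (vertex∈ j)))) (strictlyInverseʳ j)))

        vertex-surjective : ∀ x → ∃ λ i → x ≡ vertex i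
        vertex-surjective x with near-centre x
        ... | inj₁ x≡b = zero , x≡b
        ... | inj₂ b~x = suc i ,
                [ (λ eq → contradiction (sym eq) (~⇒≢ b~x)) , id ]′
                  (two-ends (to i) (~⇒≢ (centre~ i)) (centre∈ (to i)) (vertex∈ i)
                    (subst (Incident x) (sym (strictlyInverseˡ (edge j))) (right j)))
          where
          j = joining b~x
          i = from (edge j)

        agree : ∀ i j → G (vertex i) (vertex j) ≡ Star m i j
        agree zero    zero    = proj₂ simple b
        agree zero    (suc j) = T⇒≡true (centre~ j)
        agree (suc i) zero    = T⇒≡true (~-sym (centre~ i))
        agree (suc i) (suc j) = ¬T⇒≡false λ x~y → ~⇒≢ (centre~ j) (sym (leaf (centre~ i) x~y))

      path-free⇒C3-or-Star : G ≅ C3 ⊎ G ≅ Star m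
      path-free⇒C3-or-Star with cherry
      ... | a , b , c , b~a , b~c , a≢c with T? (G a c)
      ...   | yes a~c = inj₁ (triangle⇒C3 (~-sym b~a) b~c a~c)
      ...   | no a≁c  = inj₂ (open-cherry⇒Star b~a b~c a≢c a≁c)

    -- The four irreducible graphs.

    classification : ∀ {m} → HasSize G (suc m) → ¬ HasEdgeLocatingColoring G m →
                     (G ≅ P4) ⊎ (G ≅ C3) ⊎ (G ≅ C4) ⊎ (G ≅ Star (suc m))
    classification size irreducible with path₄?
    ... | yes (_ , _ , _ , _ , path) = [ inj₁ , inj₂ ∘ inj₂ ∘ inj₁ ]′ (Irreducible.path⇒P4-or-C4 size irreducible path)
    ... | no no-path = [ inj₂ ∘ inj₁ , inj₂ ∘ inj₂ ∘ inj₂ ]′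
            (PathFree.path-free⇒C3-or-Star size λ path → no-path (_ , _ , _ , _ , path))

-- Graphs in which any two edges meet or are opposite.

-- To be read together with edges `ab` and `cd`: a spanning path without the chords `ac` and `bd`.
-- Whether `a` and `d` are adjacent is left open, which covers both `P4` and `C4`.
Opposite : ∀ {n} → Graph n → (a b c d : Fin n) → Set
Opposite G a b c d = T (G b c) × ¬ T (G a c) × ¬ T (G b d) × (∀ v → v ≡ a ⊎ v ≡ b ⊎ v ≡ c ⊎ v ≡ d)

-- The four alternatives of opposition account for the two directions of each edge.
MeetingOrOpposite : ∀ {n} → Graph n → (x y z w : Fin n) → Set
MeetingOrOpposite G x y z w =
  (x ≡ z ⊎ x ≡ w ⊎ y ≡ z ⊎ y ≡ w) ⊎
  Opposite G x y z w ⊎ Opposite G y x z w ⊎ Opposite G x y w z ⊎ Opposite G y x w z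

-- A decidable property invariant under isomorphism: the three fixed graphs are settled by
-- evaluation, the stars by their common centre.
EdgesMeetOrOpposite : ∀ {n} → Graph n → Set
EdgesMeetOrOpposite G = ∀ x y z w → T (G x y) → T (G z w) → MeetingOrOpposite G x y z w

edgesMeetOrOpposite? : ∀ {n} (G : Graph n) → Dec (EdgesMeetOrOpposite G)
edgesMeetOrOpposite? G = all? λ x → all? λ y → all? λ z → all? λ w →
    T? (G x y) →-dec (T? (G z w) →-dec
      (((x ≟ z) ⊎-dec (x ≟ w) ⊎-dec (y ≟ z) ⊎-dec (y ≟ w)) ⊎-dec
      opposite? x y z w ⊎-dec opposite? y x z w ⊎-dec opposite? x y w z ⊎-dec opposite? y x w z))
  where
  opposite? : ∀ a b c d → Dec (Opposite G a b c d)
  opposite? a b c d = T? (G b c) ×-dec ¬? (T? (G a c)) ×-dec ¬? (T? (G b d)) ×-dec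
    (all? λ v → (v ≟ a) ⊎-dec (v ≟ b) ⊎-dec (v ≟ c) ⊎-dec (v ≟ d))

P4-edges : EdgesMeetOrOpposite P4
P4-edges = from-yes (edgesMeetOrOpposite? P4)

C3-edges : EdgesMeetOrOpposite C3
C3-edges = from-yes (edgesMeetOrOpposite? C3)

C4-edges : EdgesMeetOrOpposite C4
C4-edges = from-yes (edgesMeetOrOpposite? C4)

Star-edges : ∀ m → EdgesMeetOrOpposite (Star m)
Star-edges m zero    (suc _) zero    (suc _) _ _ = inj₁ (inj₁ refl)
Star-edges m zero    (suc _) (suc _) zero    _ _ = inj₁ (inj₂ (inj₁ refl))
Star-edges m (suc _) zero    zero    (suc _) _ _ = inj₁ (inj₂ (inj₂ (inj₁ refl)))
Star-edges m (suc _) zero    (suc _) zero    _ _ = inj₁ (inj₂ (inj₂ (inj₂ refl)))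

edgesMeetOrOpposite-≅ : ∀ {n k} {G : Graph n} {H : Graph k} → G ≅ H → EdgesMeetOrOpposite H → EdgesMeetOrOpposite G
edgesMeetOrOpposite-≅ {G = G} {H} (iso , agree) H-edges x y z w x~y z~w =
    pull-back (H-edges (to x) (to y) (to z) (to w) (subst T (agree x y) x~y) (subst T (agree z w) z~w))
  where
  open Inverse iso using (to; from; strictlyInverseʳ)

  inj : ∀ {u v} → to u ≡ to v → u ≡ v
  inj {u} {v} eq = trans (sym (strictlyInverseʳ u)) (trans (cong from eq) (strictlyInverseʳ v))

  opposite : ∀ {a b c d} → Opposite H (to a) (to b) (to c) (to d) → Opposite G a b c d
  opposite {a} {b} {c} {d} (b~c , a≁c , b≁d , covers) =
    subst T (sym (agree b c)) b~c , a≁c ∘ subst T (agree a c) , b≁d ∘ subst T (agree b d) ,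
    λ v → map inj (map inj (map inj inj)) (covers (to v))

  pull-back : MeetingOrOpposite H (to x) (to y) (to z) (to w) → MeetingOrOpposite G x y z w
  pull-back = map (map inj (map inj (map inj inj))) (map opposite (map opposite (map opposite opposite)))

-- All edges need different colours.

module LowerBound {n : ℕ} (G : Graph n) (simple : IsSimple G) where

  open SimpleGraph G simple

  opposite-reverse : ∀ {a b c d} → Opposite G a b c d → Opposite G d c b a
  opposite-reverse (b~c , a≁c , b≁d , covers) = ~-sym b~c , b≁d ∘ ~-sym , a≁c ∘ ~-sym , λ v →
    [ inj₂ ∘ inj₂ ∘ inj₂ , [ inj₂ ∘ inj₂ ∘ inj₁ , [ inj₂ ∘ inj₁ , inj₁ ]′ ]′ ]′ (covers v)

  module _ {k : ℕ} (col : Edge G → Fin k) where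

    -- Let `g` be an edge of colour `i` nearest to `c`. If `g` contains `b`, then `b` is at distance
    -- 0. If `g` is `f`, then `e` has its colour and contains `b`. Otherwise `g` joins `a` and `d`;
    -- both differ from `c`, so the walk from `c` has positive length, while `b` is at distance 1
    -- from `a`.
    closer : ∀ {a b c d i d₁ d₂} (e f : Edge G) → Incident a e → Incident b e → Incident c f → Incident d f →
             col e ≡ col f → a ~ b → c ~ d → a ≢ c → Opposite G a b c d →
             DistToClass G col b i d₁ → DistToClass G col c i d₂ → d₁ ≤ d₂
    closer {a} {b} {c} {d} {i} {d₁} e f a∈e b∈e c∈f d∈f e≡f a~b c~d a≢c (b~c , a≁c , _ , covers)
           (_ , min) ((g , g≡i , w , w∈g , walk) , _) = bound walk (covers w) w∈g
      where
      zero-at-b : ∀ {ℓ} → Incident b g → d₁ ≤ ℓ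
      zero-at-b b∈g = ≤-trans (min g b 0 g≡i b∈g here) z≤n

      zero-at-e : ∀ {ℓ} → Incident c g → Incident d g → d₁ ≤ ℓ
      zero-at-e c∈g d∈g = ≤-trans (min e b 0 e≡i b∈e here) z≤n
        where e≡i = trans e≡f (trans (cong col (edge-unique f g (~⇒≢ c~d) c∈f d∈f c∈g d∈g)) g≡i)

      one-at-a : ∀ {ℓ} → Incident a g → d₁ ≤ suc ℓ
      one-at-a a∈g = ≤-trans (min g a 1 g≡i a∈g (step (~-sym a~b) here)) (s≤s z≤n)

      bound : ∀ {w ℓ} → Walk G c w ℓ → w ≡ a ⊎ w ≡ b ⊎ w ≡ c ⊎ w ≡ d → Incident w g → d₁ ≤ ℓ
      bound here       (inj₁ c≡a)         _   = contradiction (sym c≡a) a≢c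
      bound (step _ _) (inj₁ refl)        a∈g = one-at-a a∈g
      bound _          (inj₂ (inj₁ refl)) b∈g = zero-at-b b∈g
      bound _          (inj₂ (inj₂ (inj₁ refl))) c∈g with otherEnd g c∈g
      ... | w′ , c~w′ , w′∈g with covers w′
      ...   | inj₁ refl               = contradiction (~-sym c~w′) a≁c
      ...   | inj₂ (inj₁ refl)        = zero-at-b w′∈g
      ...   | inj₂ (inj₂ (inj₁ refl)) = contradiction c~w′ ~-irrefl
      ...   | inj₂ (inj₂ (inj₂ refl)) = zero-at-e c∈g w′∈g
      bound here       (inj₂ (inj₂ (inj₂ c≡d)))  _   = contradiction c≡d (~⇒≢ c~d)
      bound (step _ _) (inj₂ (inj₂ (inj₂ refl))) d∈g with otherEnd g d∈g
      ... | w′ , d~w′ , w′∈g with covers w′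
      ...   | inj₁ refl               = one-at-a w′∈g
      ...   | inj₂ (inj₁ refl)        = zero-at-b w′∈g
      ...   | inj₂ (inj₂ (inj₁ refl)) = zero-at-e w′∈g d∈g
      ...   | inj₂ (inj₂ (inj₂ refl)) = contradiction d~w′ ~-irrefl

    -- With a shared colour, `closer` applied in both directions of the path would give `b` and `c`
    -- the same code.
    opposite-colours-differ : IsProperEdgeColoring G k col → IsEdgeLocating G col →
      ∀ {a b c d} (e f : Edge G) → e ≢ f → Incident a e → Incident b e → Incident c f → Incident d f →
      a ~ b → c ~ d → Opposite G a b c d → col e ≢ col f
    opposite-colours-differ (proper , _) locating {a} {b} {c} {d} e f e≢f a∈e b∈e c∈f d∈f a~b c~d opp e≡f =
        let i , d₁ , d₂ , p , q , d₁≢d₂ = locating b c (apart b∈e c∈f) in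
        d₁≢d₂ (≤-antisym
          (closer e f a∈e b∈e c∈f d∈f e≡f a~b c~d (apart a∈e c∈f) opp p q)
          (closer f e d∈f c∈f b∈e a∈e (sym e≡f) (~-sym c~d) (~-sym a~b) (≢-sym (apart b∈e d∈f)) (opposite-reverse opp) q p))
      where
      apart : ∀ {u v} → Incident u e → Incident v f → u ≢ v
      apart u∈e u∈f refl = proper e f _ e≢f u∈e u∈f e≡f

    colours-differ : IsProperEdgeColoring G k col → IsEdgeLocating G col → EdgesMeetOrOpposite G →
                     ∀ e f → e ≢ f → col e ≢ col f
    colours-differ proper locating edges e@((x , y) , _ , x~y) f@((z , w) , _ , z~w) e≢f
      with edges x y z w x~y z~w
    ... | inj₁ (inj₁ refl)               = proj₁ proper e f x e≢f (inj₁ refl) (inj₁ refl)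
    ... | inj₁ (inj₂ (inj₁ refl))        = proj₁ proper e f x e≢f (inj₁ refl) (inj₂ refl)
    ... | inj₁ (inj₂ (inj₂ (inj₁ refl))) = proj₁ proper e f y e≢f (inj₂ refl) (inj₁ refl)
    ... | inj₁ (inj₂ (inj₂ (inj₂ refl))) = proj₁ proper e f y e≢f (inj₂ refl) (inj₂ refl)
    ... | inj₂ (inj₁ opp) = opposite-colours-differ proper locating e f e≢f
            (inj₁ refl) (inj₂ refl) (inj₁ refl) (inj₂ refl) x~y z~w opp
    ... | inj₂ (inj₂ (inj₁ opp)) = opposite-colours-differ proper locating e f e≢f
            (inj₂ refl) (inj₁ refl) (inj₁ refl) (inj₂ refl) (~-sym x~y) z~w opp
    ... | inj₂ (inj₂ (inj₂ (inj₁ opp))) = opposite-colours-differ proper locating e f e≢f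
            (inj₁ refl) (inj₂ refl) (inj₂ refl) (inj₁ refl) x~y (~-sym z~w) opp
    ... | inj₂ (inj₂ (inj₂ (inj₂ opp))) = opposite-colours-differ proper locating e f e≢f
            (inj₂ refl) (inj₁ refl) (inj₂ refl) (inj₁ refl) (~-sym x~y) (~-sym z~w) opp

  -- The colouring is injective on edges, so the pigeonhole principle applies.
  size-≤-colours : ∀ {m k} → HasSize G m → EdgesMeetOrOpposite G → HasEdgeLocatingColoring G k → m ≤ k
  size-≤-colours size edges (col , proper , locating) = injective⇒≤ {f = col ∘ to} injective
    where
    open Inverse size using (to; from; strictlyInverseʳ)

    injective : ∀ {i j} → col (to i) ≡ col (to j) → i ≡ j
    injective {i} {j} eq = trans (sym (strictlyInverseʳ i)) (trans (cong from same) (strictlyInverseʳ j))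
      where same = decidable-stable (to i ≟ᴱ to j) λ e≢f → colours-differ col proper locating edges _ _ e≢f eq

theorem5 : (n : ℕ) (G : Graph n) (m : ℕ) →
    IsSimple G → Connected G → 3 ≤ n → HasSize G m → 2 ≤ m →
    (EdgeLocatingChromaticIndex G m ⇔ ((G ≅ P4) ⊎ (G ≅ C3) ⊎ (G ≅ C4) ⊎ (G ≅ Star m)))
theorem5 n G (suc m) simple conn 3≤n size _ = mk⇔
    -- The size is `suc m`, so a colouring with `m` colours would give `suc m ≤ m` by minimality.
    (λ (_ , minimal) → classification size (1+n≰n ∘ minimal m))
    [ index-m P4-edges , [ index-m C3-edges , [ index-m C4-edges , index-m (Star-edges (suc m)) ]′ ]′ ]′
  where
  open SimpleGraph.ConnectedGraph G simple conn 3≤n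

  index-m : ∀ {k} {H : Graph k} → EdgesMeetOrOpposite H → G ≅ H → EdgeLocatingChromaticIndex G (suc m)
  index-m H-edges iso = Sized.rainbow-locating size ,
    λ _ → LowerBound.size-≤-colours G simple size (edgesMeetOrOpposite-≅ iso H-edges)
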